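{- For every constant $a\ge 0$ there exist constants $c>0$ and $D$ such that every Boolean function $f:\{0,1\}^n\to\{0,1\}$ (for any $n$) with $\mathsf{alt}(f)\le a$ and $\deg(f)\ge D$ satisfies $\log_2\mathsf{sparsity}(f)\ge c\sqrt{\deg(f)}$. (That is, for Boolean functions with $\mathsf{alt}(f)=O(1)$, $\log\mathsf{sparsity}(f)=\Omega(\sqrt{\deg(f)})$.)
   Context: $\mathsf{alt}(f)$ is the maximum, over chains $0^n=x_0\prec x_1\prec\dots\prec x_n=1^n$ of distinct inputs (with $\prec$ the coordinatewise order), of the number of $i$ with $f(x_{i-1})\ne f(x_i)$. $\deg(f)$ is the degree of the unique multilinear real polynomial agreeing with $f$ on $\{0,1\}^n$. $\mathsf{sparsity}(f)$ is the number of nonzero Fourier coefficients of $1-2f$. -}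

module Defs where

open import Data.Bool using (Bool; true; false; if_then_else_)
open import Data.Nat as ℕ using (ℕ; zero; suc; NonZero; _^_)
open import Data.Fin using (Fin; zero; suc; inject₁; fromℕ)
open import Data.List as List using (List; []; _∷_; foldr; length; filter; concatMap; allFin)
open import Data.Integer using (+_)
open import Data.Rational as ℚ using (ℚ; 0ℚ; 1ℚ; _/_)
open import Data.Rational.Properties using (_≟_)
open import Data.Product using (Σ; ∃; _×_; _,_)
open import Relation.Binary.PropositionalEquality using (_≡_; _≢_)
open import Relation.Nullary.Negation using (¬_)
open import Relation.Nullary.Decidable using (¬?)
open import Data.Nat.Properties using (m^n≢0)

Input : ℕ → Set
Input n = Fin n → Bool

BoolFun : ℕ → Set
BoolFun n = Input n → Bool

cons : ∀ {n} → Bool → Input n → Input (suc n)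
cons b x zero    = b
cons b x (suc i) = x i

allInputs : (n : ℕ) → List (Input n)
allInputs zero    = (λ ()) ∷ []
allInputs (suc n) = concatMap (λ x → cons false x ∷ cons true x ∷ []) (allInputs n)

sumℚ : List ℚ → ℚ
sumℚ = foldr ℚ._+_ 0ℚ

prodℚ : List ℚ → ℚ
prodℚ = foldr ℚ._*_ 1ℚ

sumℕ : List ℕ → ℕ
sumℕ = foldr ℕ._+_ 0

b2ℚ : Bool → ℚ
b2ℚ true  = 1ℚ
b2ℚ false = 0ℚ

b2ℕ : Bool → ℕ
b2ℕ true  = 1
b2ℕ false = 0

-- Hamming weight |S| of S ⊆ [n] (given as an indicator vector).
weight : ∀ {n} → Input n → ℕ
weight {n} S = sumℕ (List.map (λ i → b2ℕ (S i)) (allFin n))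

_≤c_ : ∀ {n} → Input n → Input n → Set
_≤c_ {n} x y = ∀ (i : Fin n) → x i ≡ true → y i ≡ true

_≺_ : ∀ {n} → Input n → Input n → Set
_≺_ {n} x y = (x ≤c y) × ∃ λ (i : Fin n) → x i ≢ y i

record Chain (n : ℕ) : Set where
  field
    pt    : Fin (suc n) → Input n
    start : ∀ i → pt zero i ≡ false
    end   : ∀ i → pt (fromℕ n) i ≡ true
    step  : ∀ (i : Fin n) → pt (inject₁ i) ≺ pt (suc i)

neqB : Bool → Bool → ℕ
neqB true  false = 1
neqB false true  = 1
neqB _     _     = 0

changes : ∀ {n} → BoolFun n → Chain n → ℕ
changes {n} f ch = sumℕ (List.map (λ i → neqB (f (pt (inject₁ i))) (f (pt (suc i)))) (allFin n))
  where open Chain ch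

AltLE : ∀ {n} → BoolFun n → ℕ → Set
AltLE {n} f a = ∀ (ch : Chain n) → changes f ch ℕ.≤ a

monomial : ∀ {n} → Input n → Input n → ℚ
monomial {n} S x = prodℚ (List.map (λ i → if S i then b2ℚ (x i) else 1ℚ) (allFin n))

evalML : ∀ {n} → (Input n → ℚ) → Input n → ℚ
evalML {n} c x = sumℚ (List.map (λ S → c S ℚ.* monomial S x) (allInputs n))

HasDegLE : ∀ {n} → BoolFun n → ℕ → Set
HasDegLE {n} f d = Σ (Input n → ℚ) λ c →
  (∀ S → c S ≢ 0ℚ → weight S ℕ.≤ d) × (∀ x → evalML c x ≡ b2ℚ (f x))

IsDeg : ∀ {n} → BoolFun n → ℕ → Set
IsDeg f d = HasDegLE f d × (∀ e → HasDegLE f e → d ℕ.≤ e)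

pm : Bool → ℚ
pm true  = ℚ.- 1ℚ
pm false = 1ℚ

chi : ∀ {n} → Input n → Input n → ℚ
chi {n} S x = prodℚ (List.map (λ i → if S i then pm (x i) else 1ℚ) (allFin n))

fourier : ∀ {n} → BoolFun n → Input n → ℚ
fourier {n} f S =
  ((+ 1) / (2 ^ n)) {{m^n≢0 2 n}} ℚ.* sumℚ (List.map (λ x → pm (f x) ℚ.* chi S x) (allInputs n))

sparsity : ∀ {n} → BoolFun n → ℕ
sparsity {n} f = length (filter (λ S → ¬? (fourier f S ≟ 0ℚ)) (allInputs n))

-- log₂ s ≥ c · √d  for rational c > 0 and naturals s ≥ 1, d, expressed
-- without reals: every nonnegative rational j/k with j/k ≤ c·√d
-- (i.e. (j/k)² ≤ c²·d, as c ≥ 0) satisfies 2^(j/k) ≤ s, i.e. 2^j ≤ s^k.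
-- (By density of ℚ this is equivalent to the real inequality.)
LogGeSqrt : ℚ → ℕ → ℕ → Set
LogGeSqrt c s d = ∀ (j k : ℕ) .{{_ : NonZero k}} →
  ((+ j) / k) ℚ.* ((+ j) / k) ℚ.≤ c ℚ.* c ℚ.* ((+ d) / 1) → 2 ^ j ℕ.≤ s ^ k

{-# OPTIONS --safe #-}
module Submission where

-- Let k be the 𝔽₂-degree of f, i.e. the largest dimension of a subcube on which f has odd weight.
-- A minimal point z above x with f z ≠ f x isolates one value on the cube [x, z], which is
-- therefore odd, so z is at distance at most k from x. Climbing at most a times like this, every
-- subcube contains a point above which f is constant: fixing at most a k coordinates makes f
-- constant. Restrictions fixing these coordinates differently have the same top-degree monomials
-- over 𝔽₂, namely none, so fixing them in any way lowers the 𝔽₂-degree. After k rounds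
-- f is constant, whence deg f ≤ a k². Finally, an odd subcube of dimension k ≥ 2 forces all 2^k
-- Fourier coefficients of the restriction to be nonzero, and restricting does not increase sparsity.

open import Defs
open import Algebra.Bundles using (CommutativeRing)
import Algebra.Properties.CommutativeSemigroup as CommutativeSemigroupProperties
open import Data.Bool using (Bool; true; false; not; _xor_; if_then_else_)
open import Data.Bool.Properties using
  (xor-same; xor-∧-commutativeRing; not-¬; ¬-not; not-involutive; not-distribˡ-xor)
import Data.Bool.Properties as Bool
open import Data.Empty using (⊥; ⊥-elim)
open import Data.Fin using (Fin; zero; suc; inject₁; fromℕ)
open import Data.Integer as ℤ using (ℤ; 0ℤ)
import Data.Integer.Properties as ℤ
import Data.Integer.Tactic.RingSolver as ℤRing
open import Data.Maybe using (Maybe; just; nothing)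
open import Data.Nat as ℕ using (ℕ; zero; suc; _≤_; z≤n; s≤s; _+_; _*_)
import Data.Nat.Properties as ℕ
import Data.Nat.Tactic.RingSolver as ℕRing
open import Data.Product using (Σ; ∃; _×_; _,_; proj₁)
open import Data.Rational as ℚ using (ℚ; 0ℚ; 1ℚ; _<_)
import Data.Rational.Properties as ℚ
import Data.Rational.Unnormalised as ℚᵘ
import Data.Rational.Unnormalised.Properties as ℚᵘ
open import Data.Sum as Sum using (_⊎_; inj₁; inj₂; map₂)
open import Data.Vec using (Vec; []; _∷_; lookup; replicate; tabulate)
open import Data.Vec.Properties using (lookup-replicate; lookup∘tabulate)
open import Data.List as List using (List; []; _∷_; allFin)
open import Data.List.Properties using (map-tabulate; map-cong; filter-accept)
open import Function using (_∘_)
open import Relation.Binary.PropositionalEquality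
open import Relation.Nullary using (contradiction; Dec; yes; no; does; ¬?)

private variable
  n m l : ℕ

module ℕSum = CommutativeSemigroupProperties ℕ.+-commutativeSemigroup
module ℚSum = CommutativeSemigroupProperties
  (CommutativeRing.+-commutativeSemigroup ℚ.+-*-commutativeRing)
module ℚProd = CommutativeSemigroupProperties
  (CommutativeRing.*-commutativeSemigroup ℚ.+-*-commutativeRing)
module Xor = CommutativeSemigroupProperties
  (CommutativeRing.+-commutativeSemigroup xor-∧-commutativeRing)

-- Subcubes and translation between parallel subcubes.

-- A subcube: just b fixes a coordinate to b, ∗ leaves it free.
Cube : ℕ → Set
Cube = Vec (Maybe Bool)

pattern ∗ = nothing

dim : Cube n → ℕ
dim []           = 0
dim (just _ ∷ σ) = dim σ
dim (∗ ∷ σ)      = suc (dim σ)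

infix 4 _⊑_ _∥_

data _⊑_ : Cube n → Cube n → Set where
  []   : [] ⊑ []
  keep : ∀ {σ τ : Cube n} t → τ ⊑ σ → t ∷ τ ⊑ t ∷ σ
  fix  : ∀ {σ τ : Cube n} b → τ ⊑ σ → just b ∷ τ ⊑ ∗ ∷ σ

-- Cubes that are translates of each other.
data _∥_ : Cube n → Cube n → Set where
  []    : [] ∥ []
  star  : ∀ {σ τ : Cube n} → σ ∥ τ → ∗ ∷ σ ∥ ∗ ∷ τ
  fixed : ∀ {σ τ : Cube n} b c → σ ∥ τ → just b ∷ σ ∥ just c ∷ τ

⊑-refl : {σ : Cube n} → σ ⊑ σ
⊑-refl {σ = []}    = []
⊑-refl {σ = t ∷ σ} = keep t ⊑-refl

⊑-trans : {ρ σ τ : Cube n} → ρ ⊑ σ → σ ⊑ τ → ρ ⊑ τ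
⊑-trans []         []         = []
⊑-trans (keep t p) (keep t q) = keep t (⊑-trans p q)
⊑-trans (keep _ p) (fix b q)  = fix b (⊑-trans p q)
⊑-trans (fix b p)  (keep _ q) = fix b (⊑-trans p q)

dim-∥ : {σ τ : Cube n} → σ ∥ τ → dim σ ≡ dim τ
dim-∥ []            = refl
dim-∥ (star p)      = cong suc (dim-∥ p)
dim-∥ (fixed _ _ p) = dim-∥ p

-- Carries a subcube of one branch of a restriction over to the branch on which the function is
-- known to be constant.
translate : {σ ρ τ : Cube n} → τ ⊑ σ → σ ∥ ρ → ∃ λ τ′ → τ′ ⊑ ρ × τ ∥ τ′
translate [] [] = [] , [] , []
translate (keep _ p) (star q) with translate p q
... | τ′ , r , s = ∗ ∷ τ′ , keep ∗ r , star s
translate (keep _ p) (fixed b c q) with translate p q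
... | τ′ , r , s = just c ∷ τ′ , keep _ r , fixed b c s
translate (fix b p) (star q) with translate p q
... | τ′ , r , s = just b ∷ τ′ , fix b r , fixed b b s

-- Parity over subcubes.

-- The coefficient of the product of all free variables in the 𝔽₂-polynomial of the restriction of
-- `F`.
par : Cube n → (Vec Bool n → Bool) → Bool
par []           F = F []
par (just b ∷ σ) F = par σ (F ∘ (b ∷_))
par (∗ ∷ σ)      F = par σ λ v → F (false ∷ v) xor F (true ∷ v)

par-cong : (σ : Cube n) {F G : Vec Bool n → Bool} → F ≗ G → par σ F ≡ par σ G
par-cong []           e = e []
par-cong (just b ∷ σ) e = par-cong σ (e ∘ (b ∷_))
par-cong (∗ ∷ σ)      e = par-cong σ λ v → cong₂ _xor_ (e (false ∷ v)) (e (true ∷ v))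

par-xor : (σ : Cube n) (F G : Vec Bool n → Bool) →
  par σ (λ v → F v xor G v) ≡ par σ F xor par σ G
par-xor []           F G = refl
par-xor (just b ∷ σ) F G = par-xor σ _ _
par-xor (∗ ∷ σ)      F G = trans
  (par-cong σ λ v → Xor.interchange (F (false ∷ v)) (G (false ∷ v)) (F (true ∷ v)) (G (true ∷ v)))
  (par-xor σ _ _)

xor≡false⇒≡ : ∀ b c → b xor c ≡ false → b ≡ c
xor≡false⇒≡ false false _ = refl
xor≡false⇒≡ true  true  _ = refl

-- Translating across one fixed coordinate changes the parity by the parity over the cube with that
-- coordinate freed, which has larger dimension and is therefore even.
par-∥ : {σ τ τ′ : Cube n} (F : Vec Bool n → Bool) → τ ∥ τ′ → τ ⊑ σ → τ′ ⊑ σ →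
  (∀ {ω} → ω ⊑ σ → dim τ ℕ.< dim ω → par ω F ≡ false) → par τ F ≡ par τ′ F
par-∥ F [] [] [] even = refl
par-∥ F (star p) (keep _ q) (keep _ r) even =
  par-∥ _ p q r λ s d → even (keep ∗ s) (s≤s d)
par-∥ F (fixed b .b p) (keep _ q) (keep _ r) even =
  par-∥ _ p q r λ s d → even (keep _ s) d
par-∥ {τ = _ ∷ τ} {_ ∷ τ′} F (fixed b c p) (fix _ q) (fix _ r) even = trans (same b) (shift b c)
  where
  same : ∀ b → par τ (F ∘ (b ∷_)) ≡ par τ′ (F ∘ (b ∷_))
  same b = par-∥ _ p q r λ s d → even (fix b s) d

  flip : par τ′ (F ∘ (false ∷_)) ≡ par τ′ (F ∘ (true ∷_))
  flip = xor≡false⇒≡ _ _ (trans (sym (par-xor τ′ _ _))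
    (even (keep ∗ r) (s≤s (ℕ.≤-reflexive (dim-∥ p)))))

  shift : ∀ b c → par τ′ (F ∘ (b ∷_)) ≡ par τ′ (F ∘ (c ∷_))
  shift false false = refl
  shift true  true  = refl
  shift false true  = flip
  shift true  false = sym flip

-- Constant functions and functions with one exceptional vertex.

Const : {A : Set} → Cube n → (Vec Bool n → A) → A → Set
Const []           F c = F [] ≡ c
Const (just b ∷ σ) F c = Const σ (F ∘ (b ∷_)) c
Const (∗ ∷ σ)      F c = Const σ (F ∘ (false ∷_)) c × Const σ (F ∘ (true ∷_)) c

Const-⊑ : ∀ {A : Set} {σ τ : Cube n} {F : Vec Bool n → A} {c} → τ ⊑ σ → Const σ F c → Const τ F c
Const-⊑ []                h         = h
Const-⊑ (keep (just _) p) h         = Const-⊑ p h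
Const-⊑ (keep ∗ p)        (h₀ , h₁) = Const-⊑ p h₀ , Const-⊑ p h₁
Const-⊑ (fix false p)     (h₀ , _)  = Const-⊑ p h₀
Const-⊑ (fix true p)      (_ , h₁)  = Const-⊑ p h₁

Const-zip : ∀ {A B C : Set} (_⊕_ : A → B → C) (σ : Cube n) {F G a b} →
  Const σ F a → Const σ G b → Const σ (λ v → F v ⊕ G v) (a ⊕ b)
Const-zip _⊕_ []           p         q         = cong₂ _⊕_ p q
Const-zip _⊕_ (just _ ∷ σ) p         q         = Const-zip _⊕_ σ p q
Const-zip _⊕_ (∗ ∷ σ)      (p₀ , p₁) (q₀ , q₁) = Const-zip _⊕_ σ p₀ q₀ , Const-zip _⊕_ σ p₁ q₁

Const-xor : ∀ (σ : Cube n) {F G c} → Const σ F c → Const σ G c → Const σ (λ v → F v xor G v) false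
Const-xor σ {c = c} p q = subst (Const σ _) (xor-same c) (Const-zip _xor_ σ p q)

par-Const-false : ∀ (σ : Cube n) {F} → Const σ F false → par σ F ≡ false
par-Const-false []           p = p
par-Const-false (just b ∷ σ) p = par-Const-false σ p
par-Const-false (∗ ∷ σ) (p , q) = par-Const-false σ (Const-xor σ p q)

-- Summing over the first free direction cancels `c` against itself; the rest is identically false
-- and sums to false over a cube of any dimension, even zero.
par-Const : ∀ (σ : Cube n) {F c} → Const σ F c → 0 ℕ.< dim σ → par σ F ≡ false
par-Const (just b ∷ σ) p d = par-Const σ p d
par-Const (∗ ∷ σ) (p , q) _ = par-Const-false σ (Const-xor σ p q)

-- F is c on all of the cube but its top vertex.
Peak : Cube n → (Vec Bool n → Bool) → Bool → Set
Peak []           F c = F [] ≡ not c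
Peak (just b ∷ σ) F c = Peak σ (F ∘ (b ∷_)) c
Peak (∗ ∷ σ)      F c = Const σ (F ∘ (false ∷_)) c × Peak σ (F ∘ (true ∷_)) c

Const-xor-Peak : ∀ (σ : Cube n) {F G c} → Const σ F c → Peak σ G c →
  Peak σ (λ v → F v xor G v) false
Const-xor-Peak []           {c = false} p q = cong₂ _xor_ p q
Const-xor-Peak []           {c = true}  p q = cong₂ _xor_ p q
Const-xor-Peak (just b ∷ σ) p q = Const-xor-Peak σ p q
Const-xor-Peak (∗ ∷ σ) (p₀ , p₁) (q₀ , q₁) = Const-xor σ p₀ q₀ , Const-xor-Peak σ p₁ q₁

par-Peak-false : ∀ (σ : Cube n) {F} → Peak σ F false → par σ F ≡ true
par-Peak-false []           p = p
par-Peak-false (just b ∷ σ) p = par-Peak-false σ p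
par-Peak-false (∗ ∷ σ) (p , q) = par-Peak-false σ (Const-xor-Peak σ p q)

-- Summing over the first free direction leaves the indicator of the top vertex, whatever `c` is. In
-- dimension zero the sum would be `not c`.
par-Peak : ∀ (σ : Cube n) {F c} → Peak σ F c → 0 ℕ.< dim σ → par σ F ≡ true
par-Peak (just b ∷ σ) p d = par-Peak σ p d
par-Peak (∗ ∷ σ) (p , q) _ = par-Peak-false σ (Const-xor-Peak σ p q)

-- Minimal vertices at which the value changes.

lo hi : Cube n → Vec Bool n
lo []           = []
lo (just b ∷ σ) = b ∷ lo σ
lo (∗ ∷ σ)      = false ∷ lo σ
hi []           = []
hi (just b ∷ σ) = b ∷ hi σ
hi (∗ ∷ σ)      = true ∷ hi σ

Peak-hi : ∀ (σ : Cube n) {F c} → Peak σ F c → F (hi σ) ≡ not c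
Peak-hi []           p       = p
Peak-hi (just b ∷ σ) p       = Peak-hi σ p
Peak-hi (∗ ∷ σ)      (_ , p) = Peak-hi σ p

-- For some vertex z of σ, ω is the cube between lo σ and z and σ′ the one between z and hi σ.
data Apex : (σ ω σ′ : Cube n) → Set where
  []   : Apex [] [] []
  just : ∀ {σ ω σ′ : Cube n} b → Apex σ ω σ′ → Apex (just b ∷ σ) (just b ∷ ω) (just b ∷ σ′)
  low  : ∀ {σ ω σ′ : Cube n} → Apex σ ω σ′ → Apex (∗ ∷ σ) (just false ∷ ω) (∗ ∷ σ′)
  high : ∀ {σ ω σ′ : Cube n} → Apex σ ω σ′ → Apex (∗ ∷ σ) (∗ ∷ ω) (just true ∷ σ′)

apex-lower : {σ ω σ′ : Cube n} → Apex σ ω σ′ → ω ⊑ σ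
apex-lower []         = []
apex-lower (just b A) = keep _ (apex-lower A)
apex-lower (low A)    = fix _ (apex-lower A)
apex-lower (high A)   = keep _ (apex-lower A)

apex-upper : {σ ω σ′ : Cube n} → Apex σ ω σ′ → σ′ ⊑ σ
apex-upper []         = []
apex-upper (just b A) = keep _ (apex-upper A)
apex-upper (low A)    = keep _ (apex-upper A)
apex-upper (high A)   = fix _ (apex-upper A)

apex-dim : {σ ω σ′ : Cube n} → Apex σ ω σ′ → dim σ ≡ dim ω + dim σ′
apex-dim []         = refl
apex-dim (just b A) = apex-dim A
apex-dim (low A)    = trans (cong suc (apex-dim A)) (sym (ℕ.+-suc _ _))
apex-dim (high A)   = cong suc (apex-dim A)

apex-lo : {σ ω σ′ : Cube n} → Apex σ ω σ′ → lo ω ≡ lo σ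
apex-lo []         = refl
apex-lo (just b A) = cong (b ∷_) (apex-lo A)
apex-lo (low A)    = cong (_ ∷_) (apex-lo A)
apex-lo (high A)   = cong (_ ∷_) (apex-lo A)

apex-hi : {σ ω σ′ : Cube n} → Apex σ ω σ′ → hi ω ≡ lo σ′
apex-hi []         = refl
apex-hi (just b A) = cong (b ∷_) (apex-hi A)
apex-hi (low A)    = cong (_ ∷_) (apex-hi A)
apex-hi (high A)   = cong (_ ∷_) (apex-hi A)

hi≡lo : (σ : Cube n) → dim σ ≡ 0 → hi σ ≡ lo σ
hi≡lo []           _ = refl
hi≡lo (just b ∷ σ) d = cong (b ∷_) (hi≡lo σ d)

-- The lower half is searched first: a peak found in the upper half then has a constant lower half
-- beneath it, so it extends to a peak with the split direction free.
firstPeak : ∀ (σ : Cube n) F c →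
  Const σ F c ⊎ ∃ λ ω → ∃ λ σ′ → Apex σ ω σ′ × Peak ω F c
firstPeak [] F c with F [] Bool.≟ c
... | yes p = inj₁ p
... | no ¬p = inj₂ ([] , [] , [] , ¬-not ¬p)
firstPeak (just b ∷ σ) F c with firstPeak σ (F ∘ (b ∷_)) c
... | inj₁ p               = inj₁ p
... | inj₂ (_ , _ , A , p) = inj₂ (_ , _ , just b A , p)
firstPeak (∗ ∷ σ) F c with firstPeak σ (F ∘ (false ∷_)) c
... | inj₂ (_ , _ , A , p) = inj₂ (_ , _ , low A , p)
... | inj₁ p₀ with firstPeak σ (F ∘ (true ∷_)) c
...   | inj₁ p₁              = inj₁ (p₀ , p₁)
...   | inj₂ (_ , _ , A , p) = inj₂ (_ , _ , high A , Const-⊑ (apex-lower A) p₀ , p)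

-- Monotone paths and alternation.

infix 4 _⋖_

data _⋖_ : Vec Bool n → Vec Bool n → Set where
  here  : {v : Vec Bool n} → false ∷ v ⋖ true ∷ v
  there : ∀ {u v : Vec Bool n} b → u ⋖ v → b ∷ u ⋖ b ∷ v

data Path {n} : ℕ → Vec Bool n → Vec Bool n → Set where
  []  : ∀ {x} → Path 0 x x
  _∷_ : ∀ {x y z} → x ⋖ y → Path m y z → Path (suc m) x z

infixr 5 _++_

_++_ : {x y z : Vec Bool n} → Path l x y → Path m y z → Path (l + m) x z
[]      ++ q = q
(s ∷ p) ++ q = s ∷ (p ++ q)

prepend : ∀ {x y : Vec Bool n} b → Path m x y → Path m (b ∷ x) (b ∷ y)
prepend b []      = []
prepend b (s ∷ p) = there b s ∷ prepend b p

across : (σ : Cube n) → Path (dim σ) (lo σ) (hi σ)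
across []           = []
across (just b ∷ σ) = prepend b (across σ)
across (∗ ∷ σ)      = here ∷ prepend true (across σ)

flips : {x y : Vec Bool n} → (Vec Bool n → Bool) → Path m x y → ℕ
flips F []                    = 0
flips F (_∷_ {x = x} {y} _ p) = neqB (F x) (F y) + flips F p

flips-++ : ∀ {x y z : Vec Bool n} F (p : Path l x y) (q : Path m y z) →
  flips F (p ++ q) ≡ flips F p + flips F q
flips-++ F []      q = refl
flips-++ F (_∷_ {x = x} {y} s p) q = trans (cong (neqB (F x) (F y) +_) (flips-++ F p q))
  (sym (ℕ.+-assoc (neqB (F x) (F y)) _ _))

neqB-≢ : ∀ {b c} → b ≢ c → neqB b c ≡ 1
neqB-≢ {false} {false} h = contradiction refl h
neqB-≢ {false} {true}  h = refl
neqB-≢ {true}  {false} h = refl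
neqB-≢ {true}  {true}  h = contradiction refl h

flips-≢ : ∀ {x y : Vec Bool n} F (p : Path m x y) → F x ≢ F y → 1 ≤ flips F p
flips-≢ F [] h = contradiction refl h
flips-≢ F (_∷_ {x = x} {y} _ p) h with F x Bool.≟ F y
... | no  x≢y = ℕ.≤-trans (ℕ.≤-reflexive (sym (neqB-≢ x≢y))) (ℕ.m≤m+n _ _)
... | yes x≡y = ℕ.≤-trans (flips-≢ F p (h ∘ trans x≡y)) (ℕ.m≤n+m _ _)

-- The intervals `[0, x]` and `[x, 1]` of the Boolean lattice.
below above : Vec Bool n → Cube n
below []          = []
below (false ∷ x) = just false ∷ below x
below (true ∷ x)  = ∗ ∷ below x
above []          = []
above (false ∷ x) = ∗ ∷ above x
above (true ∷ x)  = just true ∷ above x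

bot top : (n : ℕ) → Vec Bool n
bot n = replicate n false
top n = replicate n true

lo-below : (x : Vec Bool n) → lo (below x) ≡ bot n
lo-below []          = refl
lo-below (false ∷ x) = cong (false ∷_) (lo-below x)
lo-below (true ∷ x)  = cong (false ∷_) (lo-below x)

hi-below : (x : Vec Bool n) → hi (below x) ≡ x
hi-below []          = refl
hi-below (false ∷ x) = cong (false ∷_) (hi-below x)
hi-below (true ∷ x)  = cong (true ∷_) (hi-below x)

lo-above : (x : Vec Bool n) → lo (above x) ≡ x
lo-above []          = refl
lo-above (false ∷ x) = cong (false ∷_) (lo-above x)
lo-above (true ∷ x)  = cong (true ∷_) (lo-above x)

hi-above : (x : Vec Bool n) → hi (above x) ≡ top n
hi-above []          = refl
hi-above (false ∷ x) = cong (true ∷_) (hi-above x)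
hi-above (true ∷ x)  = cong (true ∷_) (hi-above x)

-- The Hamming weight; it rises by one per step, which forces a path from bottom to top to have the
-- `n` steps of a `Chain`.
rank : Vec Bool n → ℕ
rank = dim ∘ below

rank-bot : ∀ n → rank (bot n) ≡ 0
rank-bot zero    = refl
rank-bot (suc n) = rank-bot n

rank-top : ∀ n → rank (top n) ≡ n
rank-top zero    = refl
rank-top (suc n) = cong suc (rank-top n)

rank-⋖ : {x y : Vec Bool n} → x ⋖ y → rank y ≡ suc (rank x)
rank-⋖ here            = refl
rank-⋖ (there false s) = rank-⋖ s
rank-⋖ (there true s)  = cong suc (rank-⋖ s)

rank-path : {x y : Vec Bool n} → Path m x y → rank y ≡ m + rank x
rank-path []                  = refl
rank-path {m = suc m} (s ∷ p) = trans (rank-path p) (trans (cong (m +_) (rank-⋖ s)) (ℕ.+-suc m _))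

length-full : Path m (bot n) (top n) → m ≡ n
length-full {m} {n} p = begin
  m                ≡⟨ ℕ.+-identityʳ m ⟨
  m + 0            ≡⟨ cong (m +_) (rank-bot n) ⟨
  m + rank (bot n) ≡⟨ rank-path p ⟨
  rank (top n)     ≡⟨ rank-top n ⟩
  n                ∎
  where open ≡-Reasoning

vertex : {x y : Vec Bool n} → Path m x y → Fin (suc m) → Vec Bool n
vertex {x = x} _       zero    = x
vertex         (s ∷ p) (suc i) = vertex p i

vertex-last : {x y : Vec Bool n} (p : Path m x y) → vertex p (fromℕ m) ≡ y
vertex-last []      = refl
vertex-last (s ∷ p) = vertex-last p

vertex-step : {x y : Vec Bool n} (p : Path m x y) (i : Fin m) → vertex p (inject₁ i) ⋖ vertex p (suc i)
vertex-step (s ∷ [])     zero    = s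
vertex-step (s ∷ _ ∷ _)  zero    = s
vertex-step (_ ∷ p)      (suc i) = vertex-step p i

⋖⇒≺ : {x y : Vec Bool n} → x ⋖ y → lookup x ≺ lookup y
⋖⇒≺ here = (λ { zero _ → refl ; (suc i) e → e }) , zero , λ ()
⋖⇒≺ (there b s) with ⋖⇒≺ s
... | le , i , ne = (λ { zero e → e ; (suc j) e → le j e }) , suc i , ne

chain : Path n (bot n) (top n) → Chain n
chain {n} p = record
  { pt    = lookup ∘ vertex p
  ; start = λ i → lookup-replicate i false
  ; end   = λ i → trans (cong (λ v → lookup v i) (vertex-last p)) (lookup-replicate i true)
  ; step  = ⋖⇒≺ ∘ vertex-step p
  }

map-allFin : ∀ {A : Set} n (g : Fin (suc n) → A) →
  List.map g (allFin (suc n)) ≡ g zero ∷ List.map (g ∘ suc) (allFin n)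
map-allFin n g = cong (g zero ∷_) (trans (map-tabulate suc g) (sym (map-tabulate (λ i → i) (g ∘ suc))))

flips-vertex : ∀ {x y : Vec Bool n} F (p : Path m x y) → flips F p ≡
  sumℕ (List.map (λ i → neqB (F (vertex p (inject₁ i))) (F (vertex p (suc i)))) (allFin m))
flips-vertex F []      = refl
flips-vertex {m = suc m} F (_∷_ {x = x} {y} s p) = trans
  (cong (neqB (F x) (F y) +_) (flips-vertex F p))
  (sym (cong sumℕ (map-allFin m _)))

flips-full : ∀ (f : BoolFun n) {a} → AltLE f a → (p : Path m (bot n) (top n)) →
  flips (f ∘ lookup) p ≤ a
flips-full f alt p with length-full p
... | refl = ℕ.≤-trans (ℕ.≤-reflexive (flips-vertex (f ∘ lookup) p)) (alt (chain p))

-- A path extends down to `bot n` and up to `top n`, and the added segments can only add flips.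
flips≤alt : ∀ (f : BoolFun n) {a} → AltLE f a → ∀ {x y} (p : Path m x y) →
  flips (f ∘ lookup) p ≤ a
flips≤alt {n} f alt {x} {y} p = begin
  flips F p                          ≤⟨ ℕ.m≤m+n _ _ ⟩
  flips F p + flips F above-y        ≡⟨ flips-++ F p above-y ⟨
  flips F (p ++ above-y)             ≤⟨ ℕ.m≤n+m _ _ ⟩
  flips F below-x + flips F (p ++ above-y) ≡⟨ flips-++ F below-x _ ⟨
  flips F (below-x ++ p ++ above-y)  ≤⟨ flips-full f alt (below-x ++ p ++ above-y) ⟩
  _                                  ∎
  where
  open ℕ.≤-Reasoning
  F = f ∘ lookup
  below-x : Path _ (bot n) x
  below-x = subst₂ (Path _) (lo-below x) (hi-below x) (across (below x))
  above-y : Path _ y (top n)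
  above-y = subst₂ (Path _) (lo-above y) (hi-above y) (across (above y))

-- Certificates from bounded alternation.

module _ (F : Vec Bool n → Bool) (k : ℕ) (odd⇒≤k : ∀ σ → par σ F ≡ true → dim σ ≤ k) where

  peak-dim : ∀ σ {c} → Peak σ F c → dim σ ≤ k
  peak-dim σ p with dim σ in eq
  ... | zero  = z≤n
  ... | suc d = subst (_≤ k) eq (odd⇒≤k σ (par-Peak σ p (subst (0 ℕ.<_) (sym eq) (s≤s z≤n))))

  -- Each climb to a minimal vertex of different value spends one of the `r` flips and, the cube
  -- climbed being odd, fixes at most `k` coordinates. Only paths from `lo σ` are constrained, so
  -- that the bound can drop after a climb.
  certificate : ∀ r σ → (∀ {m y} (p : Path m (lo σ) y) → flips F p ≤ r) →
    ∃ λ σ′ → ∃ λ c → σ′ ⊑ σ × Const σ′ F c × dim σ ≤ r * k + dim σ′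
  certificate r σ alt with firstPeak σ F (F (lo σ))
  ... | inj₁ h = σ , _ , ⊑-refl , h , ℕ.m≤n+m _ _
  ... | inj₂ (ω , σ₁ , A , peak) = climb r alt
    where
    p : Path (dim ω) (lo σ) (lo σ₁)
    p = subst₂ (Path _) (apex-lo A) (apex-hi A) (across ω)

    flips-p : 1 ≤ flips F p
    flips-p = flips-≢ F p λ e → not-¬ (sym e)
      (trans (cong F (sym (apex-hi A))) (Peak-hi ω peak))

    after : ∀ {r} → (∀ {m y} (p : Path m (lo σ) y) → flips F p ≤ suc r) →
      ∀ {m y} (q : Path m (lo σ₁) y) → flips F q ≤ r
    after {r} alt q = ℕ.s≤s⁻¹ (begin
      1 + flips F q         ≤⟨ ℕ.+-monoˡ-≤ _ flips-p ⟩
      flips F p + flips F q ≡⟨ flips-++ F p q ⟨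
      flips F (p ++ q)      ≤⟨ alt (p ++ q) ⟩
      suc r                 ∎)
      where open ℕ.≤-Reasoning

    climb : ∀ r → (∀ {m y} (p : Path m (lo σ) y) → flips F p ≤ r) →
      ∃ λ σ′ → ∃ λ c → σ′ ⊑ σ × Const σ′ F c × dim σ ≤ r * k + dim σ′
    -- No flip is left, yet the path to the apex has one.
    climb zero    alt = contradiction (ℕ.≤-trans flips-p (alt p)) λ ()
    climb (suc r) alt with certificate r σ₁ (after alt)
    ... | σ′ , c , le , h , d = σ′ , c , ⊑-trans le (apex-upper A) , h , (begin
        dim σ                  ≡⟨ apex-dim A ⟩
        dim ω + dim σ₁         ≤⟨ ℕ.+-mono-≤ (peak-dim ω peak) d ⟩
        k + (r * k + dim σ′)   ≡⟨ ℕ.+-assoc k _ _ ⟨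
        k + r * k + dim σ′     ∎)
      where open ℕ.≤-Reasoning

-- Derivatives over the integers and their vanishing.

-- On below x, this is the coefficient of the monomial x in the multilinear expansion of G.
der : Cube n → (Vec Bool n → ℤ) → ℤ
der []           G = G []
der (just b ∷ σ) G = der σ (G ∘ (b ∷_))
der (∗ ∷ σ)      G = der σ λ v → G (true ∷ v) ℤ.- G (false ∷ v)

der-cong : ∀ (σ : Cube n) {G H} → G ≗ H → der σ G ≡ der σ H
der-cong []           e = e []
der-cong (just b ∷ σ) e = der-cong σ (e ∘ (b ∷_))
der-cong (∗ ∷ σ)      e = der-cong σ λ v → cong₂ ℤ._-_ (e (true ∷ v)) (e (false ∷ v))

der-minus : ∀ (σ : Cube n) G H → der σ (λ v → G v ℤ.- H v) ≡ der σ G ℤ.- der σ H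
der-minus []           G H = refl
der-minus (just b ∷ σ) G H = der-minus σ _ _
der-minus (∗ ∷ σ)      G H = trans
  (der-cong σ λ v → interchange (G (true ∷ v)) (H (true ∷ v)) (G (false ∷ v)) (H (false ∷ v)))
  (der-minus σ _ _)
  where
  interchange : ∀ i j k l → i ℤ.- j ℤ.- (k ℤ.- l) ≡ i ℤ.- k ℤ.- (j ℤ.- l)
  interchange = ℤRing.solve-∀

-- The derivative over `σ` is an alternating sum of the derivatives over the translates of `ρ`
-- inside `σ`, one for each way of fixing the coordinates that `ρ` fixes.
der-branches : ∀ {σ ρ : Cube n} G → ρ ⊑ σ → (∀ {τ} → τ ⊑ σ → τ ∥ ρ → der τ G ≡ 0ℤ) → der σ G ≡ 0ℤ
der-branches G [] h = h [] []
der-branches G (keep (just b) p) h = der-branches _ p λ q r → h (keep _ q) (fixed b b r)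
der-branches G (keep ∗ p) h = der-branches _ p λ q r → h (keep _ q) (star r)
der-branches {σ = ∗ ∷ σ} G (fix b p) h =
  trans (der-minus σ _ _) (cong₂ ℤ._-_ (branch true) (branch false))
  where
  branch : ∀ c → der σ (G ∘ (c ∷_)) ≡ 0ℤ
  branch c = der-branches _ p λ q r → h (fix c q) (fixed c b r)

b2ℤ : Bool → ℤ
b2ℤ b = ℤ.+ b2ℕ b

der-Const-0 : ∀ (σ : Cube n) {G} → Const σ G 0ℤ → der σ G ≡ 0ℤ
der-Const-0 []           h       = h
der-Const-0 (just b ∷ σ) h       = der-Const-0 σ h
der-Const-0 (∗ ∷ σ)      (p , q) = der-Const-0 σ (Const-zip ℤ._-_ σ q p)

der-Const : ∀ (σ : Cube n) {G c} → Const σ G c → 0 ℕ.< dim σ → der σ G ≡ 0ℤ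
der-Const (just b ∷ σ)         h       d = der-Const σ h d
der-Const (∗ ∷ σ)      {c = c} (p , q) _ =
  der-Const-0 σ (subst (Const σ _) (ℤ.+-inverseʳ c) (Const-zip ℤ._-_ σ q p))

module _ (F : Vec Bool n → Bool) (k a : ℕ)
  (odd⇒≤k : ∀ σ → par σ F ≡ true → dim σ ≤ k)
  (alt : ∀ {m x y} (p : Path m x y) → flips F p ≤ a) where

  -- By translation to the subcube where F is constant, fixing the certificate's coordinates
  -- in any way lowers the 𝔽₂-degree e.
  der-vanishes : ∀ e σ → (∀ {τ} → τ ⊑ σ → e ℕ.< dim τ → par τ F ≡ false) →
    e * (a * k) ℕ.< dim σ → der σ (b2ℤ ∘ F) ≡ 0ℤ
  -- No subcube of positive dimension is odd here, so there is no peak and `F` is constant on `σ`.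
  der-vanishes zero σ even d with firstPeak σ F (F (lo σ))
  ... | inj₁ h = der-Const σ (Const-zip (λ b (_ : Bool) → b2ℤ b) σ h h) d
  ... | inj₂ (ω , σ₁ , A , peak) with dim ω in eq
  -- A peak of dimension zero would sit at `lo σ`, whose value is the reference value.
  ...   | zero  = contradiction (trans (cong F (sym (trans (hi≡lo ω eq) (apex-lo A)))) (Peak-hi ω peak))
                    (not-¬ refl)
  ...   | suc m = contradiction (trans (sym (par-Peak ω peak pos)) (even (apex-lower A) pos)) λ ()
    where
    pos : 0 ℕ.< dim ω
    pos = subst (0 ℕ.<_) (sym eq) (s≤s z≤n)
  der-vanishes (suc e) σ even d with certificate F k odd⇒≤k a σ alt
  ... | ρ , c , ρ⊑σ , const , codim = der-branches _ ρ⊑σ λ {σ′} σ′⊑σ σ′∥ρ →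
    der-vanishes e σ′ (evenOn σ′⊑σ σ′∥ρ) (subst (e * (a * k) ℕ.<_) (sym (dim-∥ σ′∥ρ)) dim-ρ)
    where
    dim-ρ : e * (a * k) ℕ.< dim ρ
    -- The certificate uses up one of the `suc e` shares of `a * k` dimensions. Strictness survives
    -- to the case `zero`, where it gives positive dimension.
    dim-ρ = ℕ.+-cancelˡ-< (a * k) _ _ (ℕ.<-≤-trans d codim)

    evenOn : ∀ {σ′} → σ′ ⊑ σ → σ′ ∥ ρ → ∀ {τ} → τ ⊑ σ′ → e ℕ.< dim τ → par τ F ≡ false
    evenOn σ′⊑σ σ′∥ρ {τ} τ⊑σ′ e<τ with translate τ⊑σ′ σ′∥ρ
    -- The parities of `τ` and `τ′` agree because cubes of larger dimension exceed `suc e` and are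
    -- even; on `τ′`, inside `ρ`, the function is constant.
    ... | τ′ , τ′⊑ρ , τ∥τ′ = trans
      (par-∥ F τ∥τ′ (⊑-trans τ⊑σ′ σ′⊑σ) (⊑-trans τ′⊑ρ ρ⊑σ) λ q τ<ω → even q (ℕ.≤-trans (s≤s e<τ) τ<ω))
      (par-Const τ′ (Const-⊑ τ′⊑ρ const)
        (ℕ.≤-trans (s≤s z≤n) (subst (e ℕ.<_) (dim-∥ τ∥τ′) e<τ)))

-- Integers inside the rationals, and sums over inputs.

ι : ℤ → ℚ
ι i = i ℚ./ 1

toℚᵘ-ι : ∀ i → ℚ.toℚᵘ (ι i) ℚᵘ.≃ ℚᵘ.mkℚᵘ i 0
toℚᵘ-ι i = ℚ.toℚᵘ-fromℚᵘ (ℚᵘ.mkℚᵘ i 0)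

ι-+ : ∀ i j → ι (i ℤ.+ j) ≡ ι i ℚ.+ ι j
ι-+ i j = ℚ.toℚᵘ-injective (begin
  ℚ.toℚᵘ (ι (i ℤ.+ j))                 ≈⟨ toℚᵘ-ι (i ℤ.+ j) ⟩
  ℚᵘ.mkℚᵘ (i ℤ.+ j) 0                  ≈⟨ ℚᵘ.*≡* (lemma i j) ⟩
  ℚᵘ.mkℚᵘ i 0 ℚᵘ.+ ℚᵘ.mkℚᵘ j 0         ≈⟨ ℚᵘ.+-cong (toℚᵘ-ι i) (toℚᵘ-ι j) ⟨
  ℚ.toℚᵘ (ι i) ℚᵘ.+ ℚ.toℚᵘ (ι j)       ≈⟨ ℚ.toℚᵘ-homo-+ (ι i) (ι j) ⟨
  ℚ.toℚᵘ (ι i ℚ.+ ι j)                 ∎)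
  where
  open ℚᵘ.≃-Reasoning
  lemma : ∀ i j → (i ℤ.+ j) ℤ.* ℤ.1ℤ ≡ (i ℤ.* ℤ.1ℤ ℤ.+ j ℤ.* ℤ.1ℤ) ℤ.* ℤ.1ℤ
  lemma = ℤRing.solve-∀

ι-neg : ∀ i → ι (ℤ.- i) ≡ ℚ.- ι i
ι-neg i = ℚ.toℚᵘ-injective (begin
  ℚ.toℚᵘ (ι (ℤ.- i))   ≈⟨ toℚᵘ-ι (ℤ.- i) ⟩
  ℚᵘ.- ℚᵘ.mkℚᵘ i 0     ≈⟨ ℚᵘ.-‿cong (toℚᵘ-ι i) ⟨
  ℚᵘ.- ℚ.toℚᵘ (ι i)    ≈⟨ ℚ.toℚᵘ-homo‿- (ι i) ⟨
  ℚ.toℚᵘ (ℚ.- ι i)     ∎)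
  where open ℚᵘ.≃-Reasoning

ι≡0⇒≡0 : ∀ {i} → ι i ≡ 0ℚ → i ≡ 0ℤ
ι≡0⇒≡0 {i} e with ℚ./-injective-≃ (ℚᵘ.mkℚᵘ i 0) (ℚᵘ.mkℚᵘ 0ℤ 0) e
... | ℚᵘ.*≡* p = trans (sym (ℤ.*-identityʳ i)) p

sumℚ-+ : ∀ {A : Set} (g h : A → ℚ) xs →
  sumℚ (List.map (λ x → g x ℚ.+ h x) xs) ≡ sumℚ (List.map g xs) ℚ.+ sumℚ (List.map h xs)
sumℚ-+ g h []       = sym (ℚ.+-identityʳ 0ℚ)
sumℚ-+ g h (x ∷ xs) = trans (cong (g x ℚ.+ h x ℚ.+_) (sumℚ-+ g h xs))
  (ℚSum.interchange (g x) (h x) _ _)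

sumℚ-* : ∀ {A : Set} c (g : A → ℚ) xs →
  sumℚ (List.map (λ x → c ℚ.* g x) xs) ≡ c ℚ.* sumℚ (List.map g xs)
sumℚ-* c g []       = sym (ℚ.*-zeroʳ c)
sumℚ-* c g (x ∷ xs) = trans (cong (c ℚ.* g x ℚ.+_) (sumℚ-* c g xs))
  (sym (ℚ.*-distribˡ-+ c (g x) (sumℚ (List.map g xs))))

sumℚ-cong : ∀ {A : Set} {g h : A → ℚ} → g ≗ h → ∀ xs → sumℚ (List.map g xs) ≡ sumℚ (List.map h xs)
sumℚ-cong e xs = cong sumℚ (map-cong e xs)

sumℚ-allInputs : ∀ n (h : Input (suc n) → ℚ) → sumℚ (List.map h (allInputs (suc n))) ≡
  sumℚ (List.map (λ x → h (cons false x) ℚ.+ h (cons true x)) (allInputs n))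
sumℚ-allInputs n h = go (allInputs n)
  where
  go : ∀ xs → sumℚ (List.map h (List.concatMap (λ x → cons false x ∷ cons true x ∷ []) xs)) ≡
    sumℚ (List.map (λ x → h (cons false x) ℚ.+ h (cons true x)) xs)
  go []       = refl
  go (x ∷ xs) = trans (sym (ℚ.+-assoc (h (cons false x)) (h (cons true x)) _)) 
    (cong (h (cons false x) ℚ.+ h (cons true x) ℚ.+_) (go xs))

prodℚ-allFin : ∀ n (g : Fin (suc n) → ℚ) → prodℚ (List.map g (allFin (suc n))) ≡
  g zero ℚ.* prodℚ (List.map (g ∘ suc) (allFin n))
prodℚ-allFin n g = cong prodℚ (map-allFin n g)

-- Möbius inversion and the real degree.

weight≡dim : (S : Input n) → weight S ≡ dim (below (tabulate S))
weight≡dim {zero}  S = refl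
weight≡dim {suc n} S = trans (cong sumℕ (map-allFin n _)) (first (S zero) (weight≡dim (S ∘ suc)))
  where
  first : ∀ {w} b → w ≡ dim (below (tabulate (S ∘ suc))) → b2ℕ b + w ≡ dim (below (b ∷ tabulate (S ∘ suc)))
  first false e = e
  first true  e = cong suc e

möbius : (Vec Bool n → ℤ) → Input n → ℚ
möbius G S = ι (der (below (tabulate S)) G)

ι-interpolate : ∀ (g : Bool → ℤ) b → ι (g false) ℚ.+ b2ℚ b ℚ.* ι (g true ℤ.- g false) ≡ ι (g b)
ι-interpolate g false = trans
  (cong (ι (g false) ℚ.+_) (ℚ.*-zeroˡ (ι (g true ℤ.- g false))))
  (ℚ.+-identityʳ _)
ι-interpolate g true  = begin
  ι (g false) ℚ.+ 1ℚ ℚ.* ι (g true ℤ.- g false)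
    ≡⟨ cong (ι (g false) ℚ.+_) (ℚ.*-identityˡ (ι (g true ℤ.- g false))) ⟩
  ι (g false) ℚ.+ ι (g true ℤ.- g false)
    ≡⟨ ι-+ (g false) _ ⟨
  ι (g false ℤ.+ (g true ℤ.- g false))
    ≡⟨ cong ι (lemma (g false) (g true)) ⟩
  ι (g true) ∎
  where
  open ≡-Reasoning
  lemma : ∀ i j → i ℤ.+ (j ℤ.- i) ≡ j
  lemma = ℤRing.solve-∀

-- Induction on the first variable through `G = G₀ + x₀ G₁`, with `G₁` the difference of the two
-- halves.
evalML-möbius : (G : Vec Bool n → ℤ) (x : Input n) → evalML (möbius G) x ≡ ι (G (tabulate x))
evalML-möbius {zero}  G x = trans (ℚ.+-identityʳ _) (ℚ.*-identityʳ _)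
evalML-möbius {suc n} G x = begin
  evalML (möbius G) x
    ≡⟨ sumℚ-allInputs n _ ⟩
  sumℚ (List.map (λ S → möbius G (cons false S) ℚ.* monomial (cons false S) x
                    ℚ.+ möbius G (cons true S) ℚ.* monomial (cons true S) x) (allInputs n))
    ≡⟨ sumℚ-cong split (allInputs n) ⟩
  sumℚ (List.map (λ S → möbius G₀ S ℚ.* monomial S x′
                    ℚ.+ x₀ ℚ.* (möbius G₁ S ℚ.* monomial S x′)) (allInputs n))
    ≡⟨ sumℚ-+ (λ S → möbius G₀ S ℚ.* monomial S x′) _ (allInputs n) ⟩
  evalML (möbius G₀) x′ ℚ.+ sumℚ (List.map (λ S → x₀ ℚ.* (möbius G₁ S ℚ.* monomial S x′)) (allInputs n))
    ≡⟨ cong (evalML (möbius G₀) x′ ℚ.+_) 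
         (sumℚ-* x₀ (λ S → möbius G₁ S ℚ.* monomial S x′) (allInputs n)) ⟩
  evalML (möbius G₀) x′ ℚ.+ x₀ ℚ.* evalML (möbius G₁) x′
    ≡⟨ cong₂ (λ p q → p ℚ.+ x₀ ℚ.* q) (evalML-möbius G₀ x′) (evalML-möbius G₁ x′) ⟩
  ι (G₀ (tabulate x′)) ℚ.+ x₀ ℚ.* ι (G₁ (tabulate x′))
    ≡⟨ ι-interpolate (λ b → G (b ∷ tabulate x′)) (x zero) ⟩
  ι (G (tabulate x)) ∎
  where
  open ≡-Reasoning
  x₀ = b2ℚ (x zero)
  x′ = x ∘ suc
  G₀ G₁ : Vec Bool n → ℤ
  G₀ v = G (false ∷ v)
  G₁ v = G (true ∷ v) ℤ.- G (false ∷ v)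

  split : ∀ S → möbius G (cons false S) ℚ.* monomial (cons false S) x
            ℚ.+ möbius G (cons true S) ℚ.* monomial (cons true S) x
          ≡ möbius G₀ S ℚ.* monomial S x′ ℚ.+ x₀ ℚ.* (möbius G₁ S ℚ.* monomial S x′)
  split S = cong₂ ℚ._+_
    (cong (möbius G₀ S ℚ.*_) (trans (monomial-cons false) (ℚ.*-identityˡ _)))
    (trans (cong (möbius G₁ S ℚ.*_) (monomial-cons true))
      (ℚProd.x∙yz≈y∙xz (möbius G₁ S) x₀ (monomial S x′)))
    where
    monomial-cons : ∀ b → monomial (cons b S) x ≡ (if b then x₀ else 1ℚ) ℚ.* monomial S x′
    monomial-cons b = prodℚ-allFin n λ i → if cons b S i then b2ℚ (x i) else 1ℚ

-- Inputs are functions, and a `BoolFun` could tell pointwise equal ones apart. Having a polynomial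
-- excludes this, since `evalML` only reads values; it permits passing between functions and
-- vectors.
Extensional : BoolFun n → Set
Extensional f = ∀ {x y} → x ≗ y → f x ≡ f y

b2ℚ-injective : ∀ {b c} → b2ℚ b ≡ b2ℚ c → b ≡ c
b2ℚ-injective {false} {false} _ = refl
b2ℚ-injective {true}  {true}  _ = refl

b2ℚ≡ι : ∀ b → ι (b2ℤ b) ≡ b2ℚ b
b2ℚ≡ι false = refl
b2ℚ≡ι true  = refl

evalML-cong : (c : Input n → ℚ) {x y : Input n} → x ≗ y → evalML c x ≡ evalML c y
evalML-cong {n} c e = sumℚ-cong (λ S → cong (λ p → c S ℚ.* prodℚ p)
  (map-cong (λ i → cong (λ b → if S i then b2ℚ b else 1ℚ) (e i)) (allFin n))) (allInputs n)

HasDegLE⇒Extensional : ∀ (f : BoolFun n) {d} → HasDegLE f d → Extensional f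
HasDegLE⇒Extensional f (c , _ , eval) {x} {y} e =
  b2ℚ-injective (trans (sym (eval x)) (trans (evalML-cong c e) (eval y)))

f∘tabulate : (f : BoolFun n) → Extensional f → ∀ x → f (lookup (tabulate x)) ≡ f x
f∘tabulate f ext x = ext (lookup∘tabulate x)

-- The Möbius coefficient of `S` is a derivative over a cube of dimension `weight S`.
der-vanishes⇒HasDegLE : ∀ (f : BoolFun n) {d} → Extensional f →
  (∀ σ → d ℕ.< dim σ → der σ (b2ℤ ∘ f ∘ lookup) ≡ 0ℤ) → HasDegLE f d
der-vanishes⇒HasDegLE f {d} ext vanish = möbius G , sparse , eval
  where
  G = b2ℤ ∘ f ∘ lookup

  sparse : ∀ S → möbius G S ≢ 0ℚ → weight S ≤ d
  sparse S ne = subst (_≤ d) (sym (weight≡dim S))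
    (ℕ.≮⇒≥ λ d<w → ne (cong ι (vanish (below (tabulate S)) d<w)))

  eval : ∀ x → evalML (möbius G) x ≡ b2ℚ (f x)
  eval x = trans (evalML-möbius G x) (trans (cong (ι ∘ b2ℤ) (f∘tabulate f ext x)) (b2ℚ≡ι (f x)))

-- Parity of integers.

odd : ℤ → Bool
odd (ℤ.+ zero)        = false
odd (ℤ.+ suc n)       = not (odd (ℤ.+ n))
odd ℤ.-[1+ zero ]     = true
odd ℤ.-[1+ suc n ]    = not (odd ℤ.-[1+ n ])

odd-suc : ∀ i → odd (ℤ.suc i) ≡ not (odd i)
odd-suc (ℤ.+ n)        = refl
odd-suc ℤ.-[1+ zero ]  = refl
odd-suc ℤ.-[1+ suc n ] = sym (not-involutive _)

odd-pred : ∀ i → odd (ℤ.pred i) ≡ not (odd i)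
odd-pred i = begin
  odd (ℤ.pred i)               ≡⟨ not-involutive _ ⟨
  not (not (odd (ℤ.pred i)))   ≡⟨ cong not (odd-suc (ℤ.pred i)) ⟨
  not (odd (ℤ.suc (ℤ.pred i))) ≡⟨ cong (not ∘ odd) (ℤ.suc-pred i) ⟩
  not (odd i)                  ∎
  where open ≡-Reasoning

odd-+ : ∀ i j → odd (i ℤ.+ j) ≡ odd i xor odd j
odd-+ (ℤ.+ zero)  j = cong odd (ℤ.+-identityˡ j)
odd-+ (ℤ.+ suc n) j = begin
  odd (ℤ.suc (ℤ.+ n) ℤ.+ j)      ≡⟨ cong odd (ℤ.+-assoc ℤ.1ℤ (ℤ.+ n) j) ⟩
  odd (ℤ.suc (ℤ.+ n ℤ.+ j))      ≡⟨ odd-suc (ℤ.+ n ℤ.+ j) ⟩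
  not (odd (ℤ.+ n ℤ.+ j))        ≡⟨ cong not (odd-+ (ℤ.+ n) j) ⟩
  not (odd (ℤ.+ n) xor odd j)    ≡⟨ not-distribˡ-xor (odd (ℤ.+ n)) (odd j) ⟩
  not (odd (ℤ.+ n)) xor odd j    ∎
  where open ≡-Reasoning
odd-+ ℤ.-[1+ zero ]  j = odd-pred j
odd-+ ℤ.-[1+ suc n ] j = begin
  odd (ℤ.-[1+ suc n ] ℤ.+ j)         ≡⟨ cong odd (ℤ.+-assoc ℤ.-1ℤ ℤ.-[1+ n ] j) ⟩
  odd (ℤ.pred (ℤ.-[1+ n ] ℤ.+ j))    ≡⟨ odd-pred (ℤ.-[1+ n ] ℤ.+ j) ⟩
  not (odd (ℤ.-[1+ n ] ℤ.+ j))       ≡⟨ cong not (odd-+ ℤ.-[1+ n ] j) ⟩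
  not (odd ℤ.-[1+ n ] xor odd j)     ≡⟨ not-distribˡ-xor (odd ℤ.-[1+ n ]) (odd j) ⟩
  not (odd ℤ.-[1+ n ]) xor odd j     ∎
  where open ≡-Reasoning

odd-neg : ∀ i → odd (ℤ.- i) ≡ odd i
odd-neg i = sym (xor≡false⇒≡ (odd i) (odd (ℤ.- i))
  (trans (sym (odd-+ i (ℤ.- i))) (cong odd (ℤ.+-inverseʳ i))))

odd-- : ∀ i j → odd (i ℤ.- j) ≡ odd i xor odd j
odd-- i j = trans (odd-+ i (ℤ.- j)) (cong (odd i xor_) (odd-neg j))

-- The Walsh transform and its support.

_⊞_ : (Vec Bool (suc n) → ℤ) → Bool → Vec Bool n → ℤ
(G ⊞ false) v = G (false ∷ v) ℤ.+ G (true ∷ v)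
(G ⊞ true)  v = G (false ∷ v) ℤ.- G (true ∷ v)

-- The Fourier coefficients scaled by `2 ^ n`, which keeps them integral; `⊞` is one butterfly step
-- of the fast transform.
walsh : (Vec Bool n → ℤ) → Vec Bool n → ℤ
walsh G []      = G []
walsh G (s ∷ S) = walsh (G ⊞ s) S

nonzero : ℤ → ℕ
nonzero (ℤ.+ zero) = 0
nonzero _          = 1

nonzero-≢0 : ∀ {i} → i ≢ 0ℤ → nonzero i ≡ 1
nonzero-≢0 {ℤ.+ zero}   h = contradiction refl h
nonzero-≢0 {ℤ.+ suc _}  h = refl
nonzero-≢0 {ℤ.-[1+ _ ]} h = refl

-- The number of nonzero values of walsh G.
support : (Vec Bool n → ℤ) → ℕ
support {zero}  G = nonzero (G [])
support {suc n} G = support (G ⊞ false) + support (G ⊞ true)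

-- The Walsh transform is linear, so wherever `G` has a nonzero coefficient, `A` or `B` has one too.
-- The factor `α` avoids division in ℤ.
support-combination : ∀ α β γ .{{_ : ℤ.NonZero α}} {G A B : Vec Bool n → ℤ} →
  (∀ v → α ℤ.* G v ≡ β ℤ.* A v ℤ.+ γ ℤ.* B v) → support G ≤ support A + support B
support-combination {zero} α β γ {G} {A} {B} h with A [] ℤ.≟ 0ℤ | B [] ℤ.≟ 0ℤ | G [] ℤ.≟ 0ℤ
... | _ | _ | yes g = subst (λ i → nonzero i ≤ _) (sym g) z≤n
... | no a | _ | no g =
  subst₂ _≤_ (sym (nonzero-≢0 g)) (cong (_+ nonzero (B [])) (sym (nonzero-≢0 a))) (s≤s z≤n)
... | yes _ | no b | no g =
  subst₂ _≤_ (sym (nonzero-≢0 g)) (cong (nonzero (A []) +_) (sym (nonzero-≢0 b))) (ℕ.m≤n+m 1 _)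
... | yes a | yes b | no g = contradiction (ℤ.*-cancelˡ-≡ α (G []) 0ℤ (begin
        α ℤ.* G []                      ≡⟨ h [] ⟩
        β ℤ.* A [] ℤ.+ γ ℤ.* B []       ≡⟨ cong₂ (λ i j → β ℤ.* i ℤ.+ γ ℤ.* j) a b ⟩
        β ℤ.* 0ℤ ℤ.+ γ ℤ.* 0ℤ           ≡⟨ cong₂ ℤ._+_ (ℤ.*-zeroʳ β) (ℤ.*-zeroʳ γ) ⟩
        0ℤ                              ≡⟨ ℤ.*-zeroʳ α ⟨
        α ℤ.* 0ℤ                        ∎)) g
  where open ≡-Reasoning
support-combination {suc n} α β γ {G} {A} {B} h = begin
  support (G ⊞ false) + support (G ⊞ true)
    ≤⟨ ℕ.+-mono-≤ (support-combination α β γ (half false)) (support-combination α β γ (half true)) ⟩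
  support (A ⊞ false) + support (B ⊞ false) + (support (A ⊞ true) + support (B ⊞ true))
    ≡⟨ ℕSum.interchange (support (A ⊞ false)) (support (B ⊞ false)) _ _ ⟩
  support A + support B ∎
  where
  open ℕ.≤-Reasoning
  sums : ∀ β γ a b a′ b′ → (β ℤ.* a ℤ.+ γ ℤ.* b) ℤ.+ (β ℤ.* a′ ℤ.+ γ ℤ.* b′)
    ≡ β ℤ.* (a ℤ.+ a′) ℤ.+ γ ℤ.* (b ℤ.+ b′)
  sums = ℤRing.solve-∀
  differences : ∀ β γ a b a′ b′ → (β ℤ.* a ℤ.+ γ ℤ.* b) ℤ.- (β ℤ.* a′ ℤ.+ γ ℤ.* b′)
    ≡ β ℤ.* (a ℤ.- a′) ℤ.+ γ ℤ.* (b ℤ.- b′)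
  differences = ℤRing.solve-∀
  distrib-- : ∀ α g g′ → α ℤ.* (g ℤ.- g′) ≡ α ℤ.* g ℤ.- α ℤ.* g′
  distrib-- = ℤRing.solve-∀

  half : ∀ s v → α ℤ.* (G ⊞ s) v ≡ β ℤ.* (A ⊞ s) v ℤ.+ γ ℤ.* (B ⊞ s) v
  half false v = trans (ℤ.*-distribˡ-+ α _ _) (trans (cong₂ ℤ._+_ (h (false ∷ v)) (h (true ∷ v)))
    (sums β γ (A (false ∷ v)) (B (false ∷ v)) (A (true ∷ v)) (B (true ∷ v))))
  half true  v = trans (distrib-- α (G (false ∷ v)) (G (true ∷ v))) (trans
    (cong₂ ℤ._-_ (h (false ∷ v)) (h (true ∷ v)))
    (differences β γ (A (false ∷ v)) (B (false ∷ v)) (A (true ∷ v)) (B (true ∷ v))))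

-- Twice either half is the sum or the difference of `G ⊞ false` and `G ⊞ true`, whose supports add
-- up to that of `G`.
support-restrict : ∀ (G : Vec Bool (suc n) → ℤ) b → support (G ∘ (b ∷_)) ≤ support G
support-restrict G false =
  support-combination (ℤ.+ 2) ℤ.1ℤ ℤ.1ℤ λ v → lemma (G (false ∷ v)) (G (true ∷ v))
  where
  lemma : ∀ i j → ℤ.+ 2 ℤ.* i ≡ ℤ.1ℤ ℤ.* (i ℤ.+ j) ℤ.+ ℤ.1ℤ ℤ.* (i ℤ.- j)
  lemma = ℤRing.solve-∀
support-restrict G true =
  support-combination (ℤ.+ 2) ℤ.1ℤ ℤ.-1ℤ λ v → lemma (G (false ∷ v)) (G (true ∷ v))
  where
  lemma : ∀ i j → ℤ.+ 2 ℤ.* j ≡ ℤ.1ℤ ℤ.* (i ℤ.+ j) ℤ.+ ℤ.-1ℤ ℤ.* (i ℤ.- j)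
  lemma = ℤRing.solve-∀

⊞-odd : ∀ (H : Vec Bool (suc n) → ℤ) s v → odd ((H ⊞ s) v) ≡ odd (H (false ∷ v)) xor odd (H (true ∷ v))
⊞-odd H false v = odd-+ (H (false ∷ v)) (H (true ∷ v))
⊞-odd H true  v = odd-- (H (false ∷ v)) (H (true ∷ v))

⊞-scale : ∀ c (G H : Vec Bool (suc n) → ℤ) → (∀ v → G v ≡ c ℤ.* H v) →
  ∀ s v → (G ⊞ s) v ≡ c ℤ.* (H ⊞ s) v
⊞-scale c G H h false v = trans (cong₂ ℤ._+_ (h (false ∷ v)) (h (true ∷ v))) (lemma c _ _)
  where
  lemma : ∀ c i j → c ℤ.* i ℤ.+ c ℤ.* j ≡ c ℤ.* (i ℤ.+ j)
  lemma = ℤRing.solve-∀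
⊞-scale c G H h true  v = trans (cong₂ ℤ._-_ (h (false ∷ v)) (h (true ∷ v)))
  (lemma c (H (false ∷ v)) (H (true ∷ v)))
  where
  lemma : ∀ c i j → c ℤ.* i ℤ.- c ℤ.* j ≡ c ℤ.* (i ℤ.- j)
  lemma = ℤRing.solve-∀

2^suc≤ : ∀ m {p q} → 2 ℕ.^ m ≤ p → 2 ℕ.^ m ≤ q → 2 ℕ.^ suc m ≤ p + q
2^suc≤ m {p} {q} h h′ = ℕ.+-mono-≤ h (subst (_≤ q) (sym (ℕ.+-identityʳ (2 ℕ.^ m))) h′)

-- Every Walsh coefficient of H on the cube has the parity of the sum of H over the cube.
odd⇒support : ∀ c .{{_ : ℤ.NonZero c}} (σ : Cube n) {G} H → (∀ v → G v ≡ c ℤ.* H v) →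
  par σ (odd ∘ H) ≡ true → 2 ℕ.^ dim σ ≤ support G
odd⇒support c [] {G} H h p = ℕ.≤-reflexive (sym (nonzero-≢0 {G []} λ e →
  contradiction (trans (sym p) (cong odd (H≡0 e))) λ ()))
  where
  H≡0 : G [] ≡ 0ℤ → H [] ≡ 0ℤ
  H≡0 e = ℤ.*-cancelˡ-≡ c (H []) 0ℤ (trans (sym (h [])) (trans e (sym (ℤ.*-zeroʳ c))))
odd⇒support c (just b ∷ σ) {G} H h p =
  ℕ.≤-trans (odd⇒support c σ (H ∘ (b ∷_)) (h ∘ (b ∷_)) p) (support-restrict G b)
odd⇒support c (∗ ∷ σ) {G} H h p = 2^suc≤ (dim σ) (half false) (half true)
  where
  half : ∀ s → 2 ℕ.^ dim σ ≤ support (G ⊞ s)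
  half s = odd⇒support c σ (H ⊞ s) (⊞-scale c G H h s)
    (trans (par-cong σ (⊞-odd H s)) p)

-- Odd subcubes force a large support.

sign : Bool → ℤ
sign false = ℤ.1ℤ
sign true  = ℤ.-1ℤ

-- The sum and the difference of two signs are even, so halve them before using parity.
halved : Bool → Bool → Bool → ℤ
halved false b c = ℤ.1ℤ ℤ.- b2ℤ b ℤ.- b2ℤ c
halved true  b c = b2ℤ c ℤ.- b2ℤ b

sign-+ : ∀ b c → sign b ℤ.+ sign c ≡ ℤ.+ 2 ℤ.* halved false b c
sign-+ false false = refl
sign-+ false true  = refl
sign-+ true  false = refl
sign-+ true  true  = refl

sign-- : ∀ b c → sign b ℤ.- sign c ≡ ℤ.+ 2 ℤ.* halved true b c
sign-- false false = refl
sign-- false true  = refl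
sign-- true  false = refl
sign-- true  true  = refl

sign-halved : ∀ (F : Vec Bool (suc n) → Bool) s v →
  ((sign ∘ F) ⊞ s) v ≡ ℤ.+ 2 ℤ.* halved s (F (false ∷ v)) (F (true ∷ v))
sign-halved F false v = sign-+ (F (false ∷ v)) (F (true ∷ v))
sign-halved F true  v = sign-- (F (false ∷ v)) (F (true ∷ v))

odd-halved : ∀ s b c → odd (halved s b c) ≡ not s xor (b xor c)
odd-halved false false false = refl
odd-halved false false true  = refl
odd-halved false true  false = refl
odd-halved false true  true  = refl
odd-halved true  false false = refl
odd-halved true  false true  = refl
odd-halved true  true  false = refl
odd-halved true  true  true  = refl

Const-const : ∀ {A : Set} (σ : Cube n) (c : A) → Const σ (λ _ → c) c
Const-const []           c = refl
Const-const (just _ ∷ σ) c = Const-const σ c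
Const-const (∗ ∷ σ)      c = Const-const σ c , Const-const σ c

-- The dimension bound is needed: a single variable has par true but only one nonzero coefficient.
par⇒support : ∀ (σ : Cube n) F → par σ F ≡ true → 2 ≤ dim σ → 2 ℕ.^ dim σ ≤ support (sign ∘ F)
par⇒support (just b ∷ σ) F p d =
  ℕ.≤-trans (par⇒support σ (F ∘ (b ∷_)) p d) (support-restrict (sign ∘ F) b)
par⇒support (∗ ∷ σ) F p d = 2^suc≤ (dim σ) (half false) (half true)
  where
  half : ∀ s → 2 ℕ.^ dim σ ≤ support ((sign ∘ F) ⊞ s)
  half s = odd⇒support (ℤ.+ 2) σ _ (sign-halved F s) (begin
    par σ (λ v → odd (halved s (F (false ∷ v)) (F (true ∷ v))))
      ≡⟨ par-cong σ (λ v → odd-halved s _ _) ⟩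
    par σ (λ v → not s xor (F (false ∷ v) xor F (true ∷ v)))
      ≡⟨ par-xor σ (λ _ → not s) _ ⟩
    par σ (λ _ → not s) xor par (∗ ∷ σ) F
      -- With one direction already summed, `σ` still has positive dimension, so the constant
      -- `not s` contributes nothing.
      ≡⟨ cong₂ _xor_ (par-Const σ (Const-const σ (not s)) (ℕ.s≤s⁻¹ d)) p ⟩
    true ∎)
    where open ≡-Reasoning

-- From Walsh support to sparsity.

pm≡ι : ∀ b → pm b ≡ ι (sign b)
pm≡ι false = refl
pm≡ι true  = refl

-- The first coordinate contributes a factor 1 or a sign to the character, which merges each pair of
-- terms into one butterfly step.
walsh-sum : ∀ (G : Vec Bool n → ℤ) (S : Input n) →
  sumℚ (List.map (λ x → ι (G (tabulate x)) ℚ.* chi S x) (allInputs n)) ≡ ι (walsh G (tabulate S))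
walsh-sum {zero}  G S = trans (ℚ.+-identityʳ _) (ℚ.*-identityʳ _)
walsh-sum {suc n} G S = begin
  sumℚ (List.map (λ x → ι (G (tabulate x)) ℚ.* chi S x) (allInputs (suc n)))
    ≡⟨ sumℚ-allInputs n _ ⟩
  sumℚ (List.map (λ x → ι (G (false ∷ tabulate x)) ℚ.* chi S (cons false x)
                    ℚ.+ ι (G (true ∷ tabulate x)) ℚ.* chi S (cons true x)) (allInputs n))
    ≡⟨ sumℚ-cong pair (allInputs n) ⟩
  sumℚ (List.map (λ x → ι ((G ⊞ S zero) (tabulate x)) ℚ.* chi S′ x) (allInputs n))
    ≡⟨ walsh-sum (G ⊞ S zero) S′ ⟩
  ι (walsh G (tabulate S)) ∎
  where
  open ≡-Reasoning
  S′ = S ∘ suc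

  signs : ∀ s v → ι (G (false ∷ v)) ℚ.* (if s then pm false else 1ℚ)
    ℚ.+ ι (G (true ∷ v)) ℚ.* (if s then pm true else 1ℚ) ≡ ι ((G ⊞ s) v)
  signs false v = trans
    (cong₂ ℚ._+_ (ℚ.*-identityʳ (ι (G (false ∷ v)))) (ℚ.*-identityʳ (ι (G (true ∷ v)))))
    (sym (ι-+ (G (false ∷ v)) (G (true ∷ v))))
  signs true  v = trans
    (cong₂ ℚ._+_ (ℚ.*-identityʳ (ι (G (false ∷ v))))
      (trans (sym (ℚ.neg-distribʳ-* (ι (G (true ∷ v))) 1ℚ))
        (trans (cong ℚ.-_ (ℚ.*-identityʳ _)) (sym (ι-neg (G (true ∷ v)))))))
    (sym (ι-+ (G (false ∷ v)) _))

  chi-cons : ∀ b x → chi S (cons b x) ≡ (if S zero then pm b else 1ℚ) ℚ.* chi S′ x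
  chi-cons b x = prodℚ-allFin n λ i → if S i then pm (cons b x i) else 1ℚ

  signed : Bool → Input n → ℚ
  signed b x = ι (G (b ∷ tabulate x)) ℚ.* (if S zero then pm b else 1ℚ)

  term : ∀ b x → ι (G (b ∷ tabulate x)) ℚ.* chi S (cons b x) ≡ signed b x ℚ.* chi S′ x
  term b x = trans (cong (ι (G (b ∷ tabulate x)) ℚ.*_) (chi-cons b x))
    (sym (ℚ.*-assoc (ι (G (b ∷ tabulate x))) (if S zero then pm b else 1ℚ) (chi S′ x)))

  pair : ∀ x → ι (G (false ∷ tabulate x)) ℚ.* chi S (cons false x)
            ℚ.+ ι (G (true ∷ tabulate x)) ℚ.* chi S (cons true x)
          ≡ ι ((G ⊞ S zero) (tabulate x)) ℚ.* chi S′ x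
  pair x = trans (cong₂ ℚ._+_ (term false x) (term true x))
    (trans (sym (ℚ.*-distribʳ-+ (chi S′ x) (signed false x) (signed true x)))
      (cong (ℚ._* chi S′ x) (signs (S zero) (tabulate x))))

*-cancelˡ-0 : ∀ p {q} .{{_ : ℚ.Positive p}} → p ℚ.* q ≡ 0ℚ → q ≡ 0ℚ
*-cancelˡ-0 p {q} e = ℚ.≤-antisym
  (ℚ.*-cancelˡ-≤-pos p (ℚ.≤-reflexive (trans e (sym (ℚ.*-zeroʳ p)))))
  (ℚ.*-cancelˡ-≤-pos p (ℚ.≤-reflexive (trans (ℚ.*-zeroʳ p) (sym e))))

walsh≢0⇒fourier≢0 : (f : BoolFun n) → Extensional f → ∀ S →
  walsh (sign ∘ f ∘ lookup) (tabulate S) ≢ 0ℤ → fourier f S ≢ 0ℚ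
walsh≢0⇒fourier≢0 {n} f ext S ne e = ne (ι≡0⇒≡0 (begin
  ι (walsh (sign ∘ f ∘ lookup) (tabulate S))
    ≡⟨ walsh-sum (sign ∘ f ∘ lookup) S ⟨
  sumℚ (List.map (λ x → ι (sign (f (lookup (tabulate x)))) ℚ.* chi S x) (allInputs n))
    ≡⟨ sumℚ-cong (λ x → cong (ℚ._* chi S x)
         (trans (cong (ι ∘ sign) (f∘tabulate f ext x)) (sym (pm≡ι (f x))))) (allInputs n) ⟩
  sumℚ (List.map (λ x → pm (f x) ℚ.* chi S x) (allInputs n))
    ≡⟨ *-cancelˡ-0 ((ℤ.+ 1 ℚ./ (2 ℕ.^ n)) {{ℕ.m^n≢0 2 n}})
         {{ℚ.normalize-pos 1 (2 ℕ.^ n) {{ℕ.m^n≢0 2 n}}}} e ⟩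
  0ℚ ∎))
  where open ≡-Reasoning

length-filter-cons : ∀ {P : Input (suc n) → Set} (P? : ∀ S → Dec (P S)) xs →
  List.length (List.filter P? (List.concatMap (λ x → cons false x ∷ cons true x ∷ []) xs))
  ≡ List.length (List.filter (P? ∘ cons false) xs) + List.length (List.filter (P? ∘ cons true) xs)
length-filter-cons P? [] = refl
length-filter-cons P? (x ∷ xs) with does (P? (cons false x))
... | false with does (P? (cons true x))
...   | false = length-filter-cons P? xs
...   | true  = trans (cong suc (length-filter-cons P? xs)) (sym (ℕ.+-suc _ _))
length-filter-cons P? (x ∷ xs) | true with does (P? (cons true x))
...   | false = cong suc (length-filter-cons P? xs)
...   | true  = cong suc (trans (cong suc (length-filter-cons P? xs)) (sym (ℕ.+-suc _ _)))

-- Stated for any decidable predicate implied by nonvanishing, so that the induction can fix the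
-- first coordinate of `S`.
support≤count : ∀ {P : Input n → Set} (P? : ∀ S → Dec (P S)) G →
  (∀ S → walsh G (tabulate S) ≢ 0ℤ → P S) → support G ≤ List.length (List.filter P? (allInputs n))
support≤count {zero} P? G h with G [] ℤ.≟ 0ℤ
... | yes e = subst (λ i → nonzero i ≤ _) (sym e) z≤n
... | no ne = ℕ.≤-reflexive (trans (nonzero-≢0 ne)
  (sym (cong List.length (filter-accept P? {xs = []} (h _ ne)))))
support≤count {suc n} P? G h = ℕ.≤-trans
  (ℕ.+-mono-≤ (support≤count (P? ∘ cons false) (G ⊞ false) (h ∘ cons false))
              (support≤count (P? ∘ cons true)  (G ⊞ true)  (h ∘ cons true)))
  (ℕ.≤-reflexive (sym (length-filter-cons P? (allInputs n))))

support≤sparsity : (f : BoolFun n) → Extensional f → support (sign ∘ f ∘ lookup) ≤ sparsity f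
support≤sparsity f ext = support≤count (λ S → ¬? (fourier f S ℚ.≟ 0ℚ)) _ (walsh≢0⇒fourier≢0 f ext)

-- Arithmetic and the final bound.

1/ : ℕ → ℚ
1/ a = ℤ.+ 1 ℚ./ suc a

-- Cross-multiplication in the unnormalised rationals, where numerators and denominators stay as
-- written.
clear-denominators : ∀ j k a d →
  (ℤ.+ j ℚ./ suc k) ℚ.* (ℤ.+ j ℚ./ suc k) ℚ.≤ 1/ a ℚ.* 1/ a ℚ.* (ℤ.+ d ℚ./ 1) →
  j * j * (suc a * suc a) ≤ d * (suc k * suc k)
clear-denominators j k a d h = ℤ.drop‿+≤+ (subst₂ ℤ._≤_ lhs rhs (ℚᵘ.drop-*≤* hᵘ))
  where
  frac : ∀ i m → ℚ.toℚᵘ (ℤ.+ i ℚ./ suc m) ℚᵘ.≃ ℚᵘ.mkℚᵘ (ℤ.+ i) m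
  frac i m = ℚ.toℚᵘ-fromℚᵘ (ℚᵘ.mkℚᵘ (ℤ.+ i) m)

  hom : ∀ {p q p′ q′} → ℚ.toℚᵘ p ℚᵘ.≃ p′ → ℚ.toℚᵘ q ℚᵘ.≃ q′ → ℚ.toℚᵘ (p ℚ.* q) ℚᵘ.≃ p′ ℚᵘ.* q′
  hom {p} {q} e e′ = ℚᵘ.≃-trans (ℚ.toℚᵘ-homo-* p q) (ℚᵘ.*-cong e e′)

  hᵘ : ℚᵘ.mkℚᵘ (ℤ.+ j) k ℚᵘ.* ℚᵘ.mkℚᵘ (ℤ.+ j) k ℚᵘ.≤
       ℚᵘ.mkℚᵘ (ℤ.+ 1) a ℚᵘ.* ℚᵘ.mkℚᵘ (ℤ.+ 1) a ℚᵘ.* ℚᵘ.mkℚᵘ (ℤ.+ d) 0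
  hᵘ = ℚᵘ.≤-respʳ-≃ (hom (hom (frac 1 a) (frac 1 a)) (frac d 0))
         (ℚᵘ.≤-respˡ-≃ (hom (frac j k) (frac j k)) (ℚ.toℚᵘ-mono-≤ h))

  lhs : (ℤ.+ j ℤ.* ℤ.+ j) ℤ.* ℤ.+ (suc a * suc a * 1) ≡ ℤ.+ (j * j * (suc a * suc a))
  lhs = trans (cong₂ ℤ._*_ (sym (ℤ.pos-* j j)) (cong ℤ.+_ (ℕ.*-identityʳ (suc a * suc a))))
    (sym (ℤ.pos-* (j * j) _))

  rhs : (ℤ.+ 1 ℤ.* ℤ.+ 1 ℤ.* ℤ.+ d) ℤ.* ℤ.+ (suc k * suc k) ≡ ℤ.+ (d * (suc k * suc k))
  rhs = trans (cong (ℤ._* ℤ.+ (suc k * suc k)) (ℤ.*-identityˡ (ℤ.+ d))) (sym (ℤ.pos-* d _))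

square-cancel-≤ : ∀ m n → m * m ≤ n * n → m ≤ n
square-cancel-≤ m n h = ℕ.≮⇒≥ λ n<m → ℕ.<⇒≱ (ℕ.*-mono-< n<m n<m) h

-- The first alternative is needed only for s = 0.
floorLog₂ : ∀ s → ∃ λ k → s ℕ.< 2 ℕ.^ suc k × (k ≡ 0 ⊎ 2 ℕ.^ k ≤ s)
floorLog₂ zero    = 0 , s≤s z≤n , inj₁ refl
floorLog₂ (suc s) with floorLog₂ s
... | k , s<2^k+1 , 2^k≤s with suc s ℕ.<? 2 ℕ.^ suc k
...   | yes s+1<2^k+1 = k , s+1<2^k+1 , map₂ ℕ.m≤n⇒m≤1+n 2^k≤s
...   | no  s+1≮2^k+1 = suc k , ℕ.≤-<-trans s<2^k+1 (ℕ.^-monoʳ-< 2 (s≤s (s≤s z≤n)) (ℕ.n<1+n (suc k)))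
                      , inj₂ (ℕ.≮⇒≥ s+1≮2^k+1)

-- All cubes of dimension above `k` are even, so `der-vanishes` can start with `e = k`.
degree≤ : ∀ (f : BoolFun n) {a d} k → AltLE f a → IsDeg f d →
  (∀ σ → par σ (f ∘ lookup) ≡ true → dim σ ≤ k) → d ≤ k * (a * k)
degree≤ f {a} k alt (hasDeg , least) odd⇒≤k =
  least _ (der-vanishes⇒HasDegLE f (HasDegLE⇒Extensional f hasDeg) λ σ →
    der-vanishes (f ∘ lookup) k a odd⇒≤k (flips≤alt f alt) k σ
      λ {τ} _ k<τ → ¬-not λ e → ℕ.<⇒≱ k<τ (odd⇒≤k τ e))

^-cancelʳ-< : ∀ {m n} → 2 ℕ.^ m ℕ.< 2 ℕ.^ n → m ℕ.< n
^-cancelʳ-< h = ℕ.≰⇒> λ n≤m → ℕ.<⇒≱ h (ℕ.^-monoʳ-≤ 2 n≤m)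

-- With `k` the floor of the binary logarithm of the sparsity, every odd cube of dimension at least
-- 2 has dimension at most `k`.
sparsity-bound : ∀ (f : BoolFun n) {a d} → AltLE f a → IsDeg f d → suc a ≤ d →
  ∃ λ k → d ≤ k * (a * k) × 2 ℕ.^ k ≤ sparsity f
sparsity-bound f {a} {d} alt deg a<d with floorLog₂ (sparsity f)
... | k , s<2^k+1 , 2^k≤s = choose k 2^k≤s odd⇒dim<2⊎≤k
  where
  odd⇒dim<2⊎≤k : ∀ σ → par σ (f ∘ lookup) ≡ true → dim σ ℕ.< 2 ⊎ dim σ ≤ k
  odd⇒dim<2⊎≤k σ e with 2 ℕ.≤? dim σ
  ... | no  2≰dim = inj₁ (ℕ.≰⇒> 2≰dim)
  ... | yes 2≤dim = inj₂ (ℕ.s≤s⁻¹ (^-cancelʳ-< (ℕ.≤-<-trans (ℕ.≤-trans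
    (par⇒support σ (f ∘ lookup) e 2≤dim) (support≤sparsity f (HasDegLE⇒Extensional f (proj₁ deg)))) s<2^k+1)))

  -- If `k` is at most one, so is the 𝔽₂-degree, and the degree is at most `a`, against `a<d`. This
  -- also disposes of the degenerate value of `floorLog₂`.
  small : ∀ k → k ≤ 1 → (∀ σ → par σ (f ∘ lookup) ≡ true → dim σ ℕ.< 2 ⊎ dim σ ≤ k) → ⊥
  small k k≤1 bound = ℕ.<⇒≱ a<d (ℕ.≤-trans
    (degree≤ f 1 alt deg λ σ e → Sum.[ ℕ.s≤s⁻¹ , (λ h → ℕ.≤-trans h k≤1) ] (bound σ e))
    (ℕ.≤-reflexive (trans (ℕ.*-identityˡ (a * 1)) (ℕ.*-identityʳ a))))

  choose : ∀ k → k ≡ 0 ⊎ 2 ℕ.^ k ≤ sparsity f →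
    (∀ σ → par σ (f ∘ lookup) ≡ true → dim σ ℕ.< 2 ⊎ dim σ ≤ k) →
    ∃ λ k → d ≤ k * (a * k) × 2 ℕ.^ k ≤ sparsity f
  choose 0 _ bound = ⊥-elim (small 0 z≤n bound)
  choose 1 _ bound = ⊥-elim (small 1 ℕ.≤-refl bound)
  choose k@(suc (suc _)) (inj₂ 2^k≤s) bound = k
    , degree≤ f k alt deg (λ σ e → Sum.[ (λ h → ℕ.≤-trans (ℕ.s≤s⁻¹ h) (s≤s z≤n)) , (λ h → h) ] (bound σ e))
    , 2^k≤s

theorem4 : ∀ (a : ℕ) → Σ ℚ λ c → Σ ℕ λ D → (0ℚ < c) ×
    (∀ (n : ℕ) (f : BoolFun n) (d : ℕ) → AltLE f a → IsDeg f d → D ≤ d →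
    LogGeSqrt c (sparsity f) d)
-- Since `d ≤ k * (a * k)`, any `c` with `c² a ≤ 1` works; the reciprocal of `suc a` is rational and
-- covers `a = 0`. The threshold `suc a` excludes 𝔽₂-degree at most one.
theorem4 a = 1/ a , suc a , ℚ.positive⁻¹ (1/ a) {{ℚ.normalize-pos 1 (suc a)}} , bound
  where
  bound : ∀ n f d → AltLE {n} f a → IsDeg f d → suc a ≤ d → LogGeSqrt (1/ a) (sparsity f) d
  bound n f d alt deg a<d j (suc m) h with sparsity-bound f alt deg a<d
  ... | k , d≤ , 2^k≤s = begin
    2 ℕ.^ j             ≤⟨ ℕ.^-monoʳ-≤ 2 j≤km ⟩
    2 ℕ.^ (k * suc m)   ≡⟨ ℕ.^-*-assoc 2 k (suc m) ⟨
    (2 ℕ.^ k) ℕ.^ suc m ≤⟨ ℕ.^-monoˡ-≤ (suc m) 2^k≤s ⟩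
    sparsity f ℕ.^ suc m ∎
    where
    open ℕ.≤-Reasoning
    regroup : ∀ k a m → k * (a * k) * (m * m) ≡ k * m * (k * m) * a
    regroup = ℕRing.solve-∀

    scaled : j * j * (suc a * suc a) ≤ k * suc m * (k * suc m) * (suc a * suc a)
    scaled = begin
      j * j * (suc a * suc a)                       ≤⟨ clear-denominators j m a d h ⟩
      d * (suc m * suc m)                           ≤⟨ ℕ.*-monoˡ-≤ (suc m * suc m) d≤ ⟩
      k * (a * k) * (suc m * suc m)                 ≡⟨ regroup k a (suc m) ⟩
      k * suc m * (k * suc m) * a                   ≤⟨ ℕ.*-monoʳ-≤ (k * suc m * (k * suc m))
                                                        (ℕ.≤-trans (ℕ.n≤1+n a) (ℕ.m≤m*n (suc a) (suc a))) ⟩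
      k * suc m * (k * suc m) * (suc a * suc a)     ∎

    j≤km : j ≤ k * suc m
    j≤km = square-cancel-≤ j (k * suc m)
      (ℕ.*-cancelʳ-≤ (j * j) (k * suc m * (k * suc m)) (suc a * suc a) scaled)
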